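{- Let $m,n$ be positive integers with $m<n$ and $m$ odd, and let $G$ be a connected non-complete finite simple graph with maximum degree $\Delta\geq 4$. Then $\chi(G^{\frac{m}{n}})\leq\omega(G^{\frac{m}{n}})+2$.
   Context: For a graph $G$ and positive integer $n$, the $n$-subdivision $G^{\frac{1}{n}}$ is obtained from $G$ by replacing each edge with a path of length $n$. For a graph $H$ and positive integer $m$, the $m$-th power $H^m$ is the graph on $V(H)$ in which two distinct vertices are adjacent iff their distance in $H$ is at most $m$. The fractional power is $G^{\frac{m}{n}}=(G^{\frac{1}{n}})^m$. $\chi$ denotes the chromatic number and $\omega$ the clique number. -}

module Defs where

open import Level using (0ℓ)
open import Data.Nat using (ℕ; zero; suc; _+_; _*_; _∸_; _≤_; _<_)
open import Data.Fin using (Fin; toℕ) renaming (_<_ to _<ᶠ_)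
open import Data.Bool using (Bool; true; false; if_then_else_)
open import Data.List using (List; length; map; allFin)
open import Data.Nat.ListAction using (sum)
open import Data.List.Relation.Unary.AllPairs using (AllPairs)
open import Data.Product using (Σ; ∃; _×_; _,_)
open import Data.Sum using (_⊎_; inj₁; inj₂)
open import Relation.Binary.PropositionalEquality using (_≡_; _≢_)

Odd : ℕ → Set
Odd m = ∃ λ k → m ≡ suc (2 * k)

record SimpleGraph (N : ℕ) : Set where
  field
    adj    : Fin N → Fin N → Bool
    sym    : ∀ u v → adj u v ≡ adj v u
    irrefl : ∀ u → adj u u ≡ false
open SimpleGraph public

degree : ∀ {N} → SimpleGraph N → Fin N → ℕ
degree {N} G v = sum (map (λ u → if adj G v u then 1 else 0) (allFin N))

MaxDegree≥ : ∀ {N} → SimpleGraph N → ℕ → Set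
MaxDegree≥ G d = ∃ λ v → d ≤ degree G v

record Graph : Set₁ where
  field
    V   : Set
    Adj : V → V → Set
open Graph public

data Walk (H : Graph) : ℕ → V H → V H → Set where
  here : ∀ {x} → Walk H zero x x
  step : ∀ {k x y z} → Adj H x y → Walk H k y z → Walk H (suc k) x z

toGraph : ∀ {N} → SimpleGraph N → Graph
toGraph {N} G = record { V = Fin N ; Adj = λ u v → adj G u v ≡ true }

Connected : ∀ {N} → SimpleGraph N → Set
Connected {N} G = ∀ (u v : Fin N) → ∃ λ k → Walk (toGraph G) k u v

NonComplete : ∀ {N} → SimpleGraph N → Set
NonComplete {N} G = Σ (Fin N) λ u → Σ (Fin N) λ v → u ≢ v × adj G u v ≡ false

-- n-subdivision G^{1/n}.
-- Vertices: original vertices, plus for each edge {u,v} with u < v the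
-- n-1 internal vertices; internal vertex with index j : Fin (n ∸ 1) is at
-- distance j+1 from u (and n-(j+1) from v) along the path u ... v.

InternalV : ∀ {N} → SimpleGraph N → ℕ → Set
InternalV {N} G n =
  Σ (Fin N) λ u → Σ (Fin N) λ v → (u <ᶠ v) × (adj G u v ≡ true) × Fin (n ∸ 1)

SubV : ∀ {N} → SimpleGraph N → ℕ → Set
SubV {N} G n = Fin N ⊎ InternalV G n

data SubAdj₀ {N} (G : SimpleGraph N) (n : ℕ) : SubV G n → SubV G n → Set where
  orig  : ∀ {u v} → n ≡ 1 → adj G u v ≡ true → SubAdj₀ G n (inj₁ u) (inj₁ v)
  first : ∀ {u v p q j} → toℕ j ≡ 0 →
          SubAdj₀ G n (inj₁ u) (inj₂ (u , v , p , q , j))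
  last  : ∀ {u v p q j} → suc (suc (toℕ j)) ≡ n →
          SubAdj₀ G n (inj₁ v) (inj₂ (u , v , p , q , j))
  inner : ∀ {u v p q p' q' j j'} → toℕ j' ≡ suc (toℕ j) →
          SubAdj₀ G n (inj₂ (u , v , p , q , j)) (inj₂ (u , v , p' , q' , j'))

subdivision : ∀ {N} → SimpleGraph N → ℕ → Graph
subdivision G n = record
  { V   = SubV G n
  ; Adj = λ x y → SubAdj₀ G n x y ⊎ SubAdj₀ G n y x }

power : Graph → ℕ → Graph
power H m = record
  { V   = V H
  ; Adj = λ x y → x ≢ y × ∃ λ k → k ≤ m × Walk H k x y }

fracPower : ∀ {N} → SimpleGraph N → ℕ → ℕ → Graph
fracPower G m n = power (subdivision G n) m

IsClique : (H : Graph) → List (V H) → Set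
IsClique H xs = AllPairs (λ x y → x ≢ y × Adj H x y) xs

IsCliqueNumber : Graph → ℕ → Set
IsCliqueNumber H w =
  (Σ (List (V H)) λ xs → IsClique H xs × length xs ≡ w) ×
  (∀ xs → IsClique H xs → length xs ≤ w)

Colorable : Graph → ℕ → Set
Colorable H k =
  Σ (V H → Fin k) λ c → ∀ x y → Adj H x y → c x ≢ c y

{-# OPTIONS --safe #-}
-- Write m = 2k + 1 and M = m + 1.  The darts (half-edges) of G can be coloured with Δ colours so
-- that darts at a common vertex differ and the two darts of an edge differ.  Giving the vertex at
-- distance i ≤ k from v on the dart v → u the colour (i , c v u), and all original vertices one
-- further colour, leaves only the middle segments of the subdivided edges.  These never conflict
-- with each other, so each is filled separately: with period M if M divides n, and otherwise with
-- n % M additional vertices inserted, which are coloured by two dart colours not used on that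
-- edge (here Δ ≥ 4 enters).  This takes kΔ + 4 colours, while the vertices within distance k of a
-- vertex of degree Δ together with one vertex at distance k + 1 form a clique of size kΔ + 2.
module Submission where

open import Defs renaming (sym to adj-sym)
open import Data.Nat using (ℕ; zero; suc; _+_; _*_; _∸_; _≤_; _<_; s≤s; z≤n; _≤?_; _<?_)
import Data.Nat.Properties as ℕₚ
open import Data.Nat.DivMod using (_%_; _/_; m≡m%n+[m/n]*n; m%n<n; m<n⇒m%n≡m; [m+kn]%n≡m%n; m≥n⇒m/n>0)
open import Data.Nat.ListAction using (sum)
open import Data.Nat.Solver using (module +-*-Solver)
open import Data.Bool using (true; false; if_then_else_)
import Data.Bool.Properties as Boolₚ
open import Data.Fin using (Fin; toℕ; inject≤; fromℕ<) renaming (_<_ to _<ᶠ_)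
open import Data.Fin.Patterns using (0F; 1F; 2F; 3F)
open import Data.Fin.Permutation.Components using (transpose; transpose-inverse)
open import Data.Fin.Properties using (_≟_; any?; pigeonhole; ¬∀⟶∃¬; inject≤-injective)
import Data.Fin.Properties as Finₚ
open import Data.List using (List; []; _∷_; length; lookup; map; filter; allFin; cartesianProduct; applyUpTo)
open import Data.List.Extrema ℕₚ.≤-totalOrder using (argmax; f[xs]≤f[argmax])
import Data.List.Membership.DecPropositional as DecMembership
open import Data.List.Membership.Propositional using (_∈_; _∉_)
open import Data.List.Membership.Propositional.Properties
  using (∈-allFin; ∈-lookup; ∈-filter⁺; ∈-filter⁻; ∈-cartesianProduct⁺; ∈-cartesianProduct⁻; ∈-applyUpTo⁻)
open import Data.List.Membership.Setoid.Properties using (index-injective)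
open import Data.List.Properties using (length-++; length-map; length-applyUpTo)
open import Data.List.Relation.Unary.All using ([]; _∷_)
import Data.List.Relation.Unary.All as All
import Data.List.Relation.Unary.All.Properties as Allₚ
open import Data.List.Relation.Unary.AllPairs using (AllPairs; []; _∷_)
import Data.List.Relation.Unary.AllPairs.Properties as AllPairsₚ
open import Data.List.Relation.Unary.Any using (here; there; index)
open import Data.List.Relation.Unary.Unique.Propositional using (Unique)
import Data.List.Relation.Unary.Unique.Propositional.Properties as Uniqueₚ
open import Data.Vec.Functional using (updateAt)
open import Data.Vec.Functional.Properties using (updateAt-updates; updateAt-minimal)
open import Data.Product using (∃; _×_; _,_; proj₁; proj₂)
open import Data.Sum using (_⊎_; inj₁; inj₂; swap)
open import Data.Empty using (⊥; ⊥-elim)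
open import Function using (const; _∘_; case_of_)
open import Relation.Nullary using (¬_; yes; no; Dec; contradiction)
open import Relation.Nullary.Decidable using (_×-dec_; dec-true; dec-false)
open import Relation.Binary.Definitions using (tri<; tri≈; tri>)
open import Relation.Binary.PropositionalEquality
  using (_≡_; _≢_; refl; sym; trans; cong; cong₂; subst; setoid; module ≡-Reasoning)
open import Axiom.UniquenessOfIdentityProofs.WithK using (uip)

-- Finite lists and the pigeonhole principle.

fresh : ∀ {D} (xs : List (Fin D)) → length xs < D → ∃ λ z → z ∉ xs
fresh {D} xs short = ¬∀⟶∃¬ D (_∈ xs) (_∈? xs) λ all∈ →
  let i , j , i<j , eq = pigeonhole short (index ∘ all∈)
  in Finₚ.<⇒≢ i<j (index-injective (setoid _) (all∈ i) (all∈ j) eq)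
  where open DecMembership (_≟_ {D}) using (_∈?_)

Unique⇒lookup-≢ : ∀ {A : Set} {xs : List A} → Unique xs → ∀ {i j} → i <ᶠ j → lookup xs i ≢ lookup xs j
Unique⇒lookup-≢ (x∉ ∷ _) {Fin.zero}  {Fin.suc j} _         = All.lookup x∉ (∈-lookup j)
Unique⇒lookup-≢ (_ ∷ u)  {Fin.suc i} {Fin.suc j} (s≤s i<j) = Unique⇒lookup-≢ u i<j

Unique⇒lookup-injective : ∀ {A : Set} {xs : List A} → Unique xs → ∀ {i j} → lookup xs i ≡ lookup xs j → i ≡ j
Unique⇒lookup-injective uniq {i} {j} eq with Finₚ.<-cmp i j
... | tri< i<j _ _ = contradiction eq (Unique⇒lookup-≢ uniq i<j)
... | tri≈ _ i≡j _ = i≡j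
... | tri> _ _ j<i = contradiction (sym eq) (Unique⇒lookup-≢ uniq j<i)

Unique⇒length≤ : ∀ {N} {xs : List (Fin N)} → Unique xs → length xs ≤ N
Unique⇒length≤ {xs = xs} uniq = ℕₚ.≮⇒≥ λ N< →
  let i , j , i<j , eq = pigeonhole N< (lookup xs) in Unique⇒lookup-≢ uniq i<j eq

-- Adjacency and neighbour lists.

module Neighbourhood {N} (G : SimpleGraph N) where

  infix 4 _~_
  _~_ : Fin N → Fin N → Set
  u ~ v = adj G u v ≡ true

  ~-sym : ∀ {u v} → u ~ v → v ~ u
  ~-sym u~v = trans (adj-sym G _ _) u~v

  ~-irrefl : ∀ {u v} → u ~ v → u ≢ v
  ~-irrefl {u} u~u refl with () ← trans (sym u~u) (irrefl G u)

  neighbours : Fin N → List (Fin N)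
  neighbours u = filter (λ v → adj G u v Boolₚ.≟ true) (allFin N)

  length-neighbours : ∀ u → length (neighbours u) ≡ degree G u
  length-neighbours u = go (allFin N)
    where
    go : ∀ xs → length (filter (λ v → adj G u v Boolₚ.≟ true) xs) ≡ sum (map (λ v → if adj G u v then 1 else 0) xs)
    go [] = refl
    go (v ∷ xs) with adj G u v
    ... | true  = cong suc (go xs)
    ... | false = go xs

  ∈-neighbours : ∀ {u v} → u ~ v → v ∈ neighbours u
  ∈-neighbours u~v = ∈-filter⁺ _ (∈-allFin _) u~v

-- Dart colourings, made good by pushing conflicts along trails.

module DartColouring {N} (G : SimpleGraph N) {D} (2≤D : 2 ≤ D) where

  open Neighbourhood G

  -- `c u v` is the colour of the dart from `u` to `v`. Values on non-adjacent pairs exist but are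
  -- never constrained.
  Colouring : Set
  Colouring = Fin N → Fin N → Fin D

  InjectiveAt : Fin N → (Fin N → Fin D) → Set
  InjectiveAt u f = ∀ {v w} → u ~ v → u ~ w → f v ≡ f w → v ≡ w

  Proper : Colouring → Set
  Proper c = ∀ u → InjectiveAt u (c u)

  Bad : Colouring → Fin N → Fin N → Set
  Bad c u v = u ~ v × c u v ≡ c v u

  Bad-sym : ∀ c {u v} → Bad c u v → Bad c v u
  Bad-sym _ (u~v , eq) = ~-sym u~v , sym eq

  recolour : Colouring → Fin N → (Fin N → Fin D) → Colouring
  recolour c r f = updateAt c r (const f)

  recolour-at : ∀ c r f v → recolour c r f r v ≡ f v
  recolour-at c r f v = cong (λ g → g v) (updateAt-updates r c)

  recolour-off : ∀ c {r} f {u} v → u ≢ r → recolour c r f u v ≡ c u v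
  recolour-off c f v u≢r = cong (λ g → g v) (updateAt-minimal _ _ c u≢r)

  recolour-proper : ∀ {c r f} → Proper c → InjectiveAt r f → Proper (recolour c r f)
  recolour-proper {c} {r} {f} proper inj u {v} {w} u~v u~w eq with u ≟ r
  ... | yes refl = inj u~v u~w (trans (sym (recolour-at c u f v)) (trans eq (recolour-at c u f w)))
  ... | no u≢r   = proper u u~v u~w (trans (sym (recolour-off c f v u≢r)) (trans eq (recolour-off c f w u≢r)))

  recolour-bad : ∀ {c r f u v} → Bad (recolour c r f) u v →
                 (u ≡ r × f v ≡ c v r) ⊎ (v ≡ r × f u ≡ c u r) ⊎ (u ≢ r × v ≢ r × Bad c u v)
  recolour-bad {c} {r} {f} {u} {v} (u~v , eq) with u ≟ r | v ≟ r
  ... | yes refl | yes refl = ⊥-elim (~-irrefl u~v refl)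
  ... | yes refl | no v≢r   = inj₁ (refl , trans (sym (recolour-at c u f v)) (trans eq (recolour-off c f u v≢r)))
  ... | no u≢r   | yes refl = inj₂ (inj₁ (refl , trans (sym (recolour-at c v f u)) (trans (sym eq) (recolour-off c f v u≢r))))
  ... | no u≢r   | no v≢r   = inj₂ (inj₂ (u≢r , v≢r , u~v , trans (sym (recolour-off c f v u≢r)) (trans eq (recolour-off c f u v≢r))))

  -- No new bad edge appears and `{s , r}` is cured. Excluding one orientation suffices, since `Bad`
  -- is symmetric.
  Repairs : Colouring → Fin N → Fin N → Colouring → Set
  Repairs c s r c′ = ∀ {u v} → Bad c′ u v → Bad c u v × ¬ (u ≡ s × v ≡ r)

  -- The bad edge {s , r} has been pushed to its present place along a path: from every vertex
  -- of P the dart of colour x runs along that path, so the walk can never return to P.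
  record Trail (c : Colouring) (x : Fin D) (s r : Fin N) (P : List (Fin N)) : Set where
    field
      unique : Unique P
      source : s ∈ P
      target : r ∉ P
      onward : ∀ {v} → v ∈ P → v ≢ s → ∃ λ v′ → v ~ v′ × c v v′ ≡ x × v′ ∈ P

  module _ {c : Colouring} (proper : Proper c) {s r : Fin N} (bad : Bad c s r)
           {z : Fin D} (z≢x : z ≢ c r s) where

    private
      r~s = ~-sym (proj₁ bad)
      r≢s = ~-irrefl r~s
      c-sr≡x = proj₂ bad

    -- Easy case: the colour `z` is absent at `r`, so the dart from `r` to `s` can take it.
    module Free (free : ∀ {t} → r ~ t → c r t ≢ z) where

      row : Fin N → Fin D
      row = updateAt (c r) s (const z)

      row-s : row s ≡ z
      row-s = updateAt-updates s (c r)

      row-off : ∀ {v} → v ≢ s → row v ≡ c r v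
      row-off v≢s = updateAt-minimal _ _ (c r) v≢s

      row-injective : InjectiveAt r row
      row-injective {v} {w} r~v r~w eq with v ≟ s | w ≟ s
      ... | yes refl | yes refl = refl
      ... | yes refl | no w≢s   = contradiction (trans (sym (row-off w≢s)) (trans (sym eq) row-s)) (free r~w)
      ... | no v≢s   | yes refl = contradiction (trans (sym (row-off v≢s)) (trans eq row-s)) (free r~v)
      ... | no v≢s   | no w≢s   = proper r r~v r~w (trans (sym (row-off v≢s)) (trans eq (row-off w≢s)))

      row-bad : ∀ {v} → r ~ v → row v ≡ c v r → v ≢ s × c r v ≡ c v r
      row-bad {v} r~v eq with v ≟ s
      ... | yes refl = contradiction (trans (sym row-s) (trans eq c-sr≡x)) z≢x
      ... | no v≢s   = v≢s , trans (sym (row-off v≢s)) eq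

      repairs : Repairs c s r (recolour c r row)
      repairs b with recolour-bad {c} b
      ... | inj₁ (refl , eq) = (proj₁ b , proj₂ (row-bad (proj₁ b) eq)) , λ (r≡s , _) → r≢s r≡s
      ... | inj₂ (inj₁ (refl , eq)) =
        let v≢s , eq′ = row-bad (~-sym (proj₁ b)) eq
        in (proj₁ b , sym eq′) , λ (v≡s , _) → v≢s v≡s
      ... | inj₂ (inj₂ (_ , v≢r , b′)) = b′ , λ (_ , v≡r) → v≢r v≡r

    -- The dart from `r` to `t` already has colour `z`. Exchanging the colours of the darts from `r`
    -- to `s` and to `t` keeps `r` proper and cures `{s , r}`; only `{r , t}` can become bad
    -- instead.
    module Swap {t : Fin N} (r~t : r ~ t) (t-z : c r t ≡ z) where

      t≢s : t ≢ s
      t≢s refl = z≢x (sym t-z)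

      row : Fin N → Fin D
      row = c r ∘ transpose s t

      row-injective : InjectiveAt r row
      row-injective {v} {w} r~v r~w eq =
        trans (sym (transpose-inverse t s)) (trans (cong (transpose t s)
          (proper r (~-transpose r~v) (~-transpose r~w) eq)) (transpose-inverse t s))
        where
        ~-transpose : ∀ {v} → r ~ v → r ~ transpose s t v
        ~-transpose {v} r~v with v ≟ s
        ... | yes _ = r~t
        ... | no _ with v ≟ t
        ...   | yes _ = r~s
        ...   | no _  = r~v

      row-bad : ∀ {v} → row v ≡ c v r → v ≢ s × (v ≡ t × c t r ≡ c r s ⊎ c r v ≡ c v r)
      row-bad {v} eq with v ≟ s
      ... | yes refl = contradiction (trans (sym t-z) (trans eq c-sr≡x)) z≢x
      ... | no v≢s with v ≟ t
      ...   | yes refl = v≢s , inj₁ (refl , sym eq)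
      ...   | no _     = v≢s , inj₂ eq

      row-t : row t ≡ c r s
      row-t rewrite dec-false (t ≟ s) t≢s | dec-true (t ≟ t) refl = refl

      swapped : Colouring
      swapped = recolour c r row

      swapped-bad : ∀ {u v} → Bad swapped u v →
                    (Bad c u v × ¬ (u ≡ s × v ≡ r)) ⊎
                    (c t r ≡ c r s × (u ≡ r × v ≡ t ⊎ u ≡ t × v ≡ r))
      swapped-bad b with recolour-bad {c} b
      swapped-bad b | inj₁ (refl , eq) with row-bad eq
      ... | _ , inj₁ (v≡t , e) = inj₂ (e , inj₁ (refl , v≡t))
      ... | _ , inj₂ e         = inj₁ ((proj₁ b , e) , λ (r≡s , _) → r≢s r≡s)
      swapped-bad b | inj₂ (inj₁ (refl , eq)) with row-bad eq
      ... | _   , inj₁ (u≡t , e) = inj₂ (e , inj₂ (u≡t , refl))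
      ... | u≢s , inj₂ e         = inj₁ ((proj₁ b , sym e) , λ (u≡s , _) → u≢s u≡s)
      swapped-bad b | inj₂ (inj₂ (_ , v≢r , b′)) = inj₁ (b′ , λ (_ , v≡r) → v≢r v≡r)

      trail : ∀ {P} → c t r ≡ c r s → Trail c (c r s) s r P → Trail swapped (c r s) r t (r ∷ P)
      trail {P} ctr T = record
        { unique = All.tabulate (λ v∈P r≡v → target (subst (_∈ P) (sym r≡v) v∈P)) ∷ unique
        ; source = here refl
        ; target = λ { (here t≡r) → ~-irrefl r~t (sym t≡r) ; (there t∈P) → t∉P t∈P }
        ; onward = onward′
        }
        where
        open Trail T
        -- A vertex of `P` other than `s` sends its dart of colour `c r s` into `P`. For `t` that
        -- dart leads to `r`, by properness at `t`, and `r` is outside `P`.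
        t∉P : t ∉ P
        t∉P t∈P with onward t∈P t≢s
        ... | v′ , t~v′ , eq , v′∈P =
          target (subst (_∈ P) (proper t t~v′ (~-sym r~t) (trans eq (sym ctr))) v′∈P)
        onward′ : ∀ {v} → v ∈ r ∷ P → v ≢ r →
                  ∃ λ v′ → v ~ v′ × swapped v v′ ≡ c r s × v′ ∈ r ∷ P
        onward′ (here v≡r) v≢r = contradiction v≡r v≢r
        onward′ {v} (there v∈P) v≢r with v ≟ s
        ... | yes refl = r , proj₁ bad , trans (recolour-off c row r v≢r) c-sr≡x , here refl
        ... | no v≢s with onward v∈P v≢s
        ...   | v′ , v~v′ , eq , v′∈P = v′ , v~v′ , trans (recolour-off c row v′ v≢r) eq , there v′∈P

  -- Each push of the bad edge adds a vertex to the duplicate-free list `P`. The fuel would run out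
  -- only with `N + 1` distinct vertices in `P`, so the bad edge vanishes before that.
  repair : ∀ fuel {c s r P} → Proper c → Bad c s r → Trail c (c r s) s r P →
           fuel + length P ≡ suc N → ∃ λ c′ → Proper c′ × Repairs c s r c′
  repair zero _ _ T eq = contradiction (Unique⇒length≤ (Trail.unique T)) (ℕₚ.<⇒≱ (ℕₚ.≤-reflexive (sym eq)))
  repair (suc fuel) {c} {s} {r} {P} proper bad T eq with fresh (c r s ∷ []) 2≤D
  ... | z , z∉ with any? (λ t → (adj G r t Boolₚ.≟ true) ×-dec (c r t ≟ z))
  ...   | no none = _ , recolour-proper {c} proper row-injective , repairs
    where open Free proper bad (z∉ ∘ here) (λ r~t eq → none (_ , r~t , eq))
  ...   | yes (t , r~t , t-z) with c t r ≟ c r s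
  ...     | no ctr≢x = swapped , recolour-proper {c} proper row-injective , improved
    where
    open Swap proper bad (z∉ ∘ here) r~t t-z
    improved : Repairs c s r swapped
    improved b with swapped-bad b
    ... | inj₁ good      = good
    ... | inj₂ (ctr , _) = contradiction ctr ctr≢x
  ...     | yes ctr =
    let c′ , proper′ , repairs = repair fuel (recolour-proper {c} proper row-injective) bad′
          (subst (λ x → Trail swapped x r t (r ∷ P)) (sym x≡) (trail ctr T))
          (trans (ℕₚ.+-suc fuel (length P)) eq)
    -- The edge `{r , t}` has to be excluded in both orientations, hence the use of `repairs` on `b`
    -- and on its reverse.
    in c′ , proper′ , λ b → combine (repairs b) (repairs (Bad-sym c′ b))
    where
    open Swap proper bad (z∉ ∘ here) r~t t-z
    x≡ : swapped t r ≡ c r s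
    x≡ = trans (recolour-off c row r (~-irrefl (~-sym r~t))) ctr
    bad′ : Bad swapped r t
    bad′ = r~t , trans (recolour-at c r row t) (trans row-t (sym x≡))
    combine : ∀ {u v} → Bad swapped u v × ¬ (u ≡ r × v ≡ t) →
              Bad swapped v u × ¬ (v ≡ r × u ≡ t) → Bad c u v × ¬ (u ≡ s × v ≡ r)
    combine (b , ≢rt) (_ , ≢tr) with swapped-bad b
    ... | inj₁ good                       = good
    ... | inj₂ (_ , inj₁ rt)              = contradiction rt ≢rt
    ... | inj₂ (_ , inj₂ (u≡t , v≡r))     = contradiction (v≡r , u≡t) ≢tr

  repairAll : ∀ (L : List (Fin N × Fin N)) {c} → Proper c → (∀ {u v} → Bad c u v → (u , v) ∈ L) →
              ∃ λ c′ → Proper c′ × (∀ {u v} → ¬ Bad c′ u v)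
  repairAll [] {c} proper bad∈ = c , proper , λ b → case bad∈ b of λ ()
  repairAll ((s , r) ∷ L) {c} proper bad∈ with (adj G s r Boolₚ.≟ true) ×-dec (c s r ≟ c r s)
  ... | no ¬bad = repairAll L proper λ b → drop-head b (bad∈ b)
    where
    drop-head : ∀ {u v} → Bad c u v → (u , v) ∈ (s , r) ∷ L → (u , v) ∈ L
    drop-head b (here refl) = contradiction b ¬bad
    drop-head _ (there ∈L)  = ∈L
  ... | yes bad with repair N proper bad start (ℕₚ.+-comm N 1)
    where
    start : Trail c (c r s) s r (s ∷ [])
    start = record
      { unique = [] ∷ []
      ; source = here refl
      ; target = λ { (here r≡s) → ~-irrefl (proj₁ bad) (sym r≡s) }
      ; onward = λ { (here v≡s) v≢s → contradiction v≡s v≢s }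
      }
  ...   | c′ , proper′ , repairs = repairAll L proper′ λ b → drop-head (repairs b) (bad∈ (proj₁ (repairs b)))
    where
    drop-head : ∀ {u v} → Bad c u v × ¬ (u ≡ s × v ≡ r) → (u , v) ∈ (s , r) ∷ L → (u , v) ∈ L
    drop-head (_ , ≢sr) (here refl) = contradiction (refl , refl) ≢sr
    drop-head _         (there ∈L)  = ∈L

  -- The start is the colouring of each dart by the index of its target in the neighbour list, which
  -- is already proper.
  dartColouring : (∀ u → degree G u ≤ D) → ∃ λ c → Proper c × (∀ {u v} → ¬ Bad c u v)
  dartColouring Δ≤D = repairAll (cartesianProduct (allFin N) (allFin N)) {rank} rank-proper
    λ _ → ∈-cartesianProduct⁺ (∈-allFin _) (∈-allFin _)
    where
    open DecMembership (_≟_ {N}) using (_∈?_)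
    len≤ : ∀ u → length (neighbours u) ≤ D
    len≤ u = ℕₚ.≤-trans (ℕₚ.≤-reflexive (length-neighbours u)) (Δ≤D u)
    rank : Colouring
    rank u v with v ∈? neighbours u
    ... | yes v∈ = inject≤ (index v∈) (len≤ u)
    -- Placeholder for non-adjacent pairs, which `Proper` and `Bad` ignore.
    ... | no _   = inject≤ {2} Fin.zero 2≤D
    rank-proper : Proper rank
    rank-proper u {v} {w} u~v u~w eq with v ∈? neighbours u | w ∈? neighbours u
    ... | yes v∈ | yes w∈ = index-injective (setoid _) v∈ w∈ (inject≤-injective _ _ _ _ eq)
    ... | no v∉  | _      = contradiction (∈-neighbours u~v) v∉
    ... | yes _  | no w∉  = contradiction (∈-neighbours u~w) w∉

-- The sequence of symbols along one subdivided edge.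

-- The colours along a subdivided edge of length n, by position: a level together with a symbol.
-- Symbols 0F and 2F stand for the colours of the darts at the start and at the end of the edge,
-- 1F and 3F for two colours distinct from both; only levels 1 … k carry dart colours.
module Pattern (k r q : ℕ) (r<M : r < suc k + suc k) where

  M n : ℕ
  M = suc k + suc k
  n = r + suc q * M

  Symbol : Set
  Symbol = ℕ × Fin 4

  -- The level is the distance to the nearest multiple of `M`, and the symbol tells the two halves
  -- of the period apart, so different residues get different symbols.
  periodic : ℕ → Symbol
  periodic ρ with ρ ≤? suc k
  ... | yes _ = ρ , 0F
  ... | no _  = M ∸ ρ , 2F

  -- The additional vertex with y additional vertices before it and z after it.  At distance i > k
  -- from an end the level has to be at least M ∸ i, to avoid the other darts at that end.
  filler : ℕ → ℕ → Symbol
  filler y z with y <? z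
  ... | yes _ = k ∸ y , 3F
  ... | no _  = suc k ∸ z , 1F

  -- The `r` additional vertices sit directly behind position `suc k`. Deleting them leaves the
  -- periodic sequence, in which `near {p}` has index `p` and `far x` has index `x`.
  data Position : ℕ → Set where
    near  : ∀ {p} → p ≤ suc k → Position p
    extra : ∀ y z → suc (y + z) ≡ r → Position (suc (suc k) + y)
    far   : ∀ x → suc k < x → Position (r + x)

  position : ∀ p → Position p
  position p with p ≤? suc k
  ... | yes p≤ = near p≤
  ... | no p≰ with ℕₚ.m≤n⇒∃[o]m+o≡n (ℕₚ.≰⇒> p≰)
  ...   | y , refl with y <? r
  ...     | yes y<r = let z , eq = ℕₚ.m≤n⇒∃[o]m+o≡n y<r in extra y z eq
  ...     | no y≮r with ℕₚ.m≤n⇒∃[o]m+o≡n (ℕₚ.≮⇒≥ y≮r)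
  ...       | w , refl = subst Position
    (solve 3 (λ r k w → r :+ (con 2 :+ k :+ w) := con 2 :+ k :+ (r :+ w)) refl r k w)
    (far (suc (suc k) + w) (ℕₚ.m≤m+n _ w))
    where open +-*-Solver

  symbolAt : ∀ {p} → Position p → Symbol
  symbolAt (near {p} _)  = p , 0F
  symbolAt (extra y z _) = filler y z
  symbolAt (far x _)     = periodic (x % M)

  periodic-low : ∀ {ρ} → ρ ≤ suc k → periodic ρ ≡ (ρ , 0F)
  periodic-low {ρ} ρ≤ with ρ ≤? suc k
  ... | yes _ = refl
  ... | no ρ≰ = contradiction ρ≤ ρ≰

  periodic-high : ∀ {ρ} → suc k < ρ → periodic ρ ≡ (M ∸ ρ , 2F)
  periodic-high {ρ} <ρ with ρ ≤? suc k
  ... | yes ρ≤ = contradiction ρ≤ (ℕₚ.<⇒≱ <ρ)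
  ... | no _   = refl

  periodic-injective : ∀ {ρ σ} → ρ < M → σ < M → periodic ρ ≡ periodic σ → ρ ≡ σ
  periodic-injective {ρ} {σ} ρ<M σ<M eq with ρ ≤? suc k | σ ≤? suc k
  ... | yes _ | yes _ = cong proj₁ eq
  ... | yes _ | no _  = case cong proj₂ eq of λ ()
  ... | no _  | yes _ = case cong proj₂ eq of λ ()
  ... | no _  | no _  = ℕₚ.∸-cancelˡ-≡ (ℕₚ.<⇒≤ ρ<M) (ℕₚ.<⇒≤ σ<M) (cong proj₁ eq)

  -- Fillers use only the symbols `1F` and `3F`, periodic positions only `0F` and `2F`.
  filler≢periodic : ∀ y z ρ → filler y z ≢ periodic ρ
  filler≢periodic y z ρ eq with y <? z | ρ ≤? suc k
  ... | yes _ | yes _ = case cong proj₂ eq of λ ()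
  ... | yes _ | no _  = case cong proj₂ eq of λ ()
  ... | no _  | yes _ = case cong proj₂ eq of λ ()
  ... | no _  | no _  = case cong proj₂ eq of λ ()

  -- From `r < M` follows `y + z ≤ 2k`, so the smaller summand is at most `k`. Hence the truncated
  -- subtractions in `filler` are exact.
  min≤k : ∀ {y z} → suc (y + z) ≡ r → y ≤ z → y ≤ k
  min≤k {y} {z} eq y≤z = ℕₚ.≮⇒≥ λ k<y → ℕₚ.<⇒≱ r<M (begin
    M             ≤⟨ ℕₚ.+-mono-≤ k<y (ℕₚ.≤-trans k<y y≤z) ⟩
    y + z         ≤⟨ ℕₚ.n≤1+n _ ⟩
    suc (y + z)   ≡⟨ eq ⟩
    r             ∎)
    where open ℕₚ.≤-Reasoning

  -- The strict version keeps the fillers with symbol `3F` off level 0.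
  min<k : ∀ {y z} → suc (y + z) ≡ r → y < z → y < k
  min<k {y} {z} eq y<z = ℕₚ.≮⇒≥ λ k<1+y → ℕₚ.<⇒≱ r<M (begin
    suc k + suc k     ≤⟨ ℕₚ.+-mono-≤ k<1+y (ℕₚ.≤-trans k<1+y y<z) ⟩
    suc y + z         ≡⟨ eq ⟩
    r                 ∎)
    where open ℕₚ.≤-Reasoning

  swap-sum : ∀ {y z} → suc (y + z) ≡ r → suc (z + y) ≡ r
  swap-sum {y} {z} eq = trans (cong suc (ℕₚ.+-comm z y)) eq

  filler-injective : ∀ {y z y′ z′} → suc (y + z) ≡ r → suc (y′ + z′) ≡ r →
                     filler y z ≡ filler y′ z′ → y ≡ y′
  filler-injective {y} {z} {y′} {z′} e e′ eq with y <? z | y′ <? z′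
  ... | yes y<z | yes y<z′ =
    ℕₚ.∸-cancelˡ-≡ (min≤k e (ℕₚ.<⇒≤ y<z)) (min≤k e′ (ℕₚ.<⇒≤ y<z′)) (cong proj₁ eq)
  ... | yes _   | no _  = case cong proj₂ eq of λ ()
  ... | no _    | yes _ = case cong proj₂ eq of λ ()
  ... | no y≮z  | no y≮z′ with ℕₚ.∸-cancelˡ-≡ {m = suc k}
          (ℕₚ.m≤n⇒m≤1+n (min≤k (swap-sum {y} e) (ℕₚ.≮⇒≥ y≮z)))
          (ℕₚ.m≤n⇒m≤1+n (min≤k (swap-sum {y′} e′) (ℕₚ.≮⇒≥ y≮z′))) (cong proj₁ eq)
  ...   | refl = ℕₚ.+-cancelʳ-≡ z y y′ (ℕₚ.suc-injective (trans e (sym e′)))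

  -- With equal residues the quotients would differ by at least one, and so `x` and `x′` by at least
  -- `M`.
  %-window : ∀ {x x′} → x < x′ → x′ < x + M → x % M ≢ x′ % M
  %-window {x} {x′} x<x′ x′<x+M eq = ℕₚ.<⇒≱ x′<x+M (begin
    x + M                          ≡⟨ cong (_+ M) (m≡m%n+[m/n]*n x M) ⟩
    ρ + x / M * M + M              ≡⟨ solve 3 (λ ρ q m → ρ :+ q :* m :+ m := ρ :+ (con 1 :+ q) :* m) refl ρ (x / M) M ⟩
    ρ + suc (x / M) * M            ≤⟨ ℕₚ.+-monoʳ-≤ ρ (ℕₚ.*-monoˡ-≤ M quotients) ⟩
    ρ + x′ / M * M                 ≡⟨ x′≡ ⟨
    x′                             ∎)
    where
    open ℕₚ.≤-Reasoning
    open +-*-Solver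
    ρ = x % M
    x′≡ : x′ ≡ ρ + x′ / M * M
    x′≡ = trans (m≡m%n+[m/n]*n x′ M) (cong (_+ x′ / M * M) (sym eq))
    quotients : x / M < x′ / M
    quotients = ℕₚ.*-cancelʳ-< M _ _ (ℕₚ.+-cancelˡ-< ρ _ _
      (subst (ρ + x / M * M <_) x′≡ (subst (_< x′) (m≡m%n+[m/n]*n x M) x<x′)))

  low<M : ∀ {p} → p ≤ suc k → p < M
  low<M p≤ = s≤s (ℕₚ.≤-trans p≤ (ℕₚ.m≤n+m (suc k) k))

  -- Fillers never meet periodic symbols and are told apart by `y`. Deleting the additional vertices
  -- does not widen the gap between two periodic positions, so their indices stay distinct and less
  -- than `M` apart.
  symbolAt-window : ∀ {p p′} (v : Position p) (v′ : Position p′) →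
                    p < p′ → p′ < p + M → symbolAt v ≢ symbolAt v′
  symbolAt-window (near _) (near _) p<p′ _ eq = ℕₚ.<⇒≢ p<p′ (cong proj₁ eq)
  symbolAt-window (near p≤) (extra y z _) _ _ eq = filler≢periodic y z _ (trans (sym eq) (sym (periodic-low p≤)))
  symbolAt-window (near {p} p≤) (far x <x) _ p′< eq =
    %-window (ℕₚ.≤-<-trans p≤ <x) (ℕₚ.≤-<-trans (ℕₚ.m≤n+m x r) p′<)
      (trans (m<n⇒m%n≡m (low<M p≤))
        (periodic-injective (low<M p≤) (m%n<n x M) (trans (periodic-low p≤) eq)))
  symbolAt-window (extra y z _) (near p≤) _ _ eq = filler≢periodic y z _ (trans eq (sym (periodic-low p≤)))
  symbolAt-window (extra y z e) (extra y′ z′ e′) p<p′ _ eq =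
    ℕₚ.<⇒≢ p<p′ (cong (suc (suc k) +_) (filler-injective e e′ eq))
  symbolAt-window (extra y z _) (far x _) _ _ eq = filler≢periodic y z _ eq
  symbolAt-window (far x <x) (near p≤) p<p′ _ _ =
    ℕₚ.<⇒≱ <x (ℕₚ.≤-trans (ℕₚ.m≤n+m x r) (ℕₚ.≤-trans (ℕₚ.<⇒≤ p<p′) p≤))
  symbolAt-window (far x _) (extra y z _) _ _ eq = filler≢periodic y z _ (sym eq)
  symbolAt-window (far x _) (far x′ _) p<p′ p′< eq =
    %-window (ℕₚ.+-cancelˡ-< r _ _ p<p′)
      (ℕₚ.+-cancelˡ-< r _ _ (subst (r + x′ <_) (ℕₚ.+-assoc r x M) p′<))
      (periodic-injective (m%n<n x M) (m%n<n x′ M) eq)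

  level : Symbol → ℕ
  level = proj₁

  start-near : ∀ {p} (v : Position p) → p ≤ k → symbolAt v ≡ (p , 0F)
  start-near (near _) _ = refl
  start-near (extra y _ _) p≤k =
    contradiction p≤k (ℕₚ.<⇒≱ (s≤s (ℕₚ.≤-trans (ℕₚ.n≤1+n k) (ℕₚ.m≤m+n (suc k) y))))
  start-near (far x <x) p≤k = contradiction (ℕₚ.≤-trans (ℕₚ.m≤n+m x r) p≤k) (ℕₚ.<⇒≱ (ℕₚ.<-trans (ℕₚ.n<1+n k) <x))

  -- Another dart at the same end has level `i` at distance `i ≤ k`. It can conflict with position
  -- `p` only if `i + p < M`, and then a level of at least `M ∸ p` differs from `i`.
  start-level : ∀ {p} (v : Position p) → k < p → M ≤ level (symbolAt v) + p
  start-level (near _) k<p = ℕₚ.+-mono-≤ k<p k<p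
  start-level (extra y z e) _ with y <? z
  -- Tight: for `p = k + 2 + y` the level `k ∸ y` equals `M ∸ p`.
  ... | yes y<z = ℕₚ.≤-reflexive (begin
    M                             ≡⟨ cong (λ t → suc t + suc t) (ℕₚ.m∸n+n≡m y≤k) ⟨
    suc (d + y) + suc (d + y)     ≡⟨ solve 2 (λ d y → con 1 :+ (d :+ y) :+ (con 1 :+ (d :+ y)) := d :+ (con 2 :+ (d :+ y) :+ y)) refl d y ⟩
    d + (suc (suc (d + y)) + y)   ≡⟨ cong (λ t → d + (suc (suc t) + y)) (ℕₚ.m∸n+n≡m y≤k) ⟩
    d + (suc (suc k) + y)         ∎)
    where
    open ≡-Reasoning
    open +-*-Solver
    y≤k = min≤k e (ℕₚ.<⇒≤ y<z)
    d = k ∸ y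
  ... | no y≮z = begin
    suc k + suc k                        ≡⟨ cong (_+ suc k) (ℕₚ.m∸n+n≡m z≤1+k) ⟨
    d + z + suc k                        ≤⟨ ℕₚ.+-mono-≤ (ℕₚ.+-monoʳ-≤ d (ℕₚ.≮⇒≥ y≮z)) (ℕₚ.n≤1+n _) ⟩
    d + y + suc (suc k)                  ≡⟨ ℕₚ.+-assoc d y _ ⟩
    d + (y + suc (suc k))                ≡⟨ cong (d +_) (ℕₚ.+-comm y _) ⟩
    d + (suc (suc k) + y)                ∎
    where
    open ℕₚ.≤-Reasoning
    d = suc k ∸ z
    z≤1+k = ℕₚ.m≤n⇒m≤1+n (min≤k (swap-sum {y} e) (ℕₚ.≮⇒≥ y≮z))
  start-level (far x <x) _ with M ≤? x
  ... | yes M≤x = ℕₚ.≤-trans M≤x (ℕₚ.≤-trans (ℕₚ.m≤n+m x r) (ℕₚ.m≤n+m _ (level (periodic (x % M)))))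
  ... | no M≰x rewrite m<n⇒m%n≡m (ℕₚ.≰⇒> M≰x) | periodic-high <x = begin
    M                  ≡⟨ ℕₚ.m∸n+n≡m (ℕₚ.<⇒≤ (ℕₚ.≰⇒> M≰x)) ⟨
    M ∸ x + x          ≤⟨ ℕₚ.+-monoʳ-≤ (M ∸ x) (ℕₚ.m≤n+m x r) ⟩
    M ∸ x + (r + x)    ∎
    where open ℕₚ.≤-Reasoning

  -- Without the additional vertices the edge has length `suc q * M`, a multiple of the period, so
  -- counting back from the end respects residues.
  far-residue : ∀ {x i} → 0 < i → i ≤ M → r + x + i ≡ n → x % M ≡ M ∸ i
  far-residue {x} {i} 0<i i≤M eq = begin
    x % M                    ≡⟨ cong (_% M) x≡ ⟩
    (M ∸ i + q * M) % M      ≡⟨ [m+kn]%n≡m%n (M ∸ i) q M ⟩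
    (M ∸ i) % M              ≡⟨ m<n⇒m%n≡m (ℕₚ.∸-monoʳ-< 0<i i≤M) ⟩
    M ∸ i                    ∎
    where
    open ≡-Reasoning
    x≡ : x ≡ M ∸ i + q * M
    x≡ = ℕₚ.+-cancelʳ-≡ i x _ (ℕₚ.+-cancelˡ-≡ r _ _ (begin
      r + (x + i)                  ≡⟨ ℕₚ.+-assoc r x i ⟨
      r + x + i                    ≡⟨ eq ⟩
      r + (M + q * M)              ≡⟨ cong (λ t → r + (t + q * M)) (ℕₚ.m∸n+n≡m i≤M) ⟨
      r + (M ∸ i + i + q * M)      ≡⟨ cong (r +_) (solve 3 (λ a i b → a :+ i :+ b := a :+ b :+ i) refl (M ∸ i) i (q * M)) ⟩
      r + (M ∸ i + q * M + i)      ∎))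
      where open +-*-Solver

  r+M≤n : r + M ≤ n
  r+M≤n = ℕₚ.+-monoʳ-≤ r (ℕₚ.m≤m+n M (q * M))

  -- Since `r + M ≤ n`, the last `k` inner positions all lie behind the additional vertices.
  end-near : ∀ {p i} (v : Position p) → p + i ≡ n → 0 < i → i ≤ k → symbolAt v ≡ (i , 2F)
  end-near {p} {i} (near p≤) eq _ i≤k = contradiction (subst (M ≤_) (sym eq) (ℕₚ.≤-trans (ℕₚ.m≤n+m M r) r+M≤n))
    (ℕₚ.<⇒≱ (ℕₚ.+-mono-≤-< p≤ (s≤s i≤k)))
  end-near {i = i} (extra y z e) eq _ i≤k = contradiction r+M≤n (ℕₚ.<⇒≱ (begin-strict
    n                          ≡⟨ eq ⟨
    suc (suc k) + y + i        <⟨ ℕₚ.+-mono-<-≤ (ℕₚ.+-monoʳ-< (suc (suc k)) (subst (y <_) e (s≤s (ℕₚ.m≤m+n y z)))) i≤k ⟩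
    suc (suc k) + r + k        ≡⟨ solve 2 (λ k r → con 2 :+ k :+ r :+ k := r :+ (con 1 :+ k :+ (con 1 :+ k))) refl k r ⟩
    r + M                      ∎))
    where
    open ℕₚ.≤-Reasoning
    open +-*-Solver
  end-near {i = i} (far x _) eq 0<i i≤k = begin
    periodic (x % M)           ≡⟨ cong periodic (far-residue 0<i i≤M eq) ⟩
    periodic (M ∸ i)           ≡⟨ periodic-high (ℕₚ.m+n≤o⇒m≤o∸n _ (ℕₚ.≤-trans (ℕₚ.+-monoʳ-≤ (suc (suc k)) i≤k) (ℕₚ.≤-reflexive (cong suc (sym (ℕₚ.+-suc k k)))))) ⟩
    M ∸ (M ∸ i) , 2F           ≡⟨ cong (_, 2F) (ℕₚ.m∸[m∸n]≡n i≤M) ⟩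
    i , 2F                     ∎
    where
    open ≡-Reasoning
    i≤M = ℕₚ.≤-trans i≤k (ℕₚ.<⇒≤ (low<M (ℕₚ.n≤1+n k)))

  -- Amounts to `z + suc k ≤ i`: behind this additional vertex come `z` more, and the end is at
  -- least `suc k` steps further on.
  extra-bound : ∀ {y z i} → suc (y + z) ≡ r → suc (suc k) + y + i ≡ n → z + M ≤ suc k + i
  extra-bound {y} {z} {i} e eq = ℕₚ.+-cancelˡ-≤ (suc y) _ _ (begin
    suc y + (z + M)            ≡⟨ ℕₚ.+-assoc (suc y) z M ⟨
    suc (y + z) + M            ≡⟨ cong (_+ M) e ⟩
    r + M                      ≤⟨ r+M≤n ⟩
    n                          ≡⟨ eq ⟨
    suc (suc k) + y + i        ≡⟨ solve 3 (λ k y i → con 2 :+ k :+ y :+ i := con 1 :+ y :+ (con 1 :+ k :+ i)) refl k y i ⟩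
    suc y + (suc k + i)        ∎)
    where
    open ℕₚ.≤-Reasoning
    open +-*-Solver

  end-level : ∀ {p i} (v : Position p) → p + i ≡ n → k < i → M ≤ level (symbolAt v) + i
  end-level {p} {i} v eq k<i with M ≤? i
  ... | yes M≤i = ℕₚ.≤-trans M≤i (ℕₚ.m≤n+m i _)
  end-level (near _) eq k<i | no _ = subst (M ≤_) (sym eq) (ℕₚ.≤-trans (ℕₚ.m≤n+m M r) r+M≤n)
  end-level {i = i} (extra y z e) eq k<i | no _ with y <? z
  ... | yes y<z = ℕₚ.+-cancelˡ-≤ y _ _ (ℕₚ.+-cancelˡ-≤ 1 _ _ (begin
    suc y + M                  ≤⟨ ℕₚ.+-monoˡ-≤ M y<z ⟩
    z + M                      ≤⟨ z+M≤ ⟩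
    suc k + i                  ≡⟨ cong (λ t → suc t + i) (ℕₚ.m+[n∸m]≡n y≤k) ⟨
    suc (y + (k ∸ y)) + i      ≡⟨ cong suc (ℕₚ.+-assoc y _ i) ⟩
    suc (y + (k ∸ y + i))      ∎))
    where
    open ℕₚ.≤-Reasoning
    y≤k = min≤k e (ℕₚ.<⇒≤ y<z)
    z+M≤ = extra-bound e eq
  ... | no y≮z = ℕₚ.+-cancelˡ-≤ z _ _ (begin
    z + M                      ≤⟨ extra-bound e eq ⟩
    suc k + i                  ≡⟨ cong (_+ i) (ℕₚ.m+[n∸m]≡n z≤1+k) ⟨
    z + (suc k ∸ z) + i        ≡⟨ ℕₚ.+-assoc z _ i ⟩
    z + (suc k ∸ z + i)        ∎)
    where
    open ℕₚ.≤-Reasoning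
    z≤1+k = ℕₚ.m≤n⇒m≤1+n (min≤k (swap-sum {y} e) (ℕₚ.≮⇒≥ y≮z))
  end-level {i = i} (far x _) eq k<i | no M≰i = begin
    M                                  ≡⟨ ℕₚ.m∸n+n≡m i≤M ⟨
    M ∸ i + i                          ≡⟨ cong (λ s → level s + i) (periodic-low M∸i≤) ⟨
    level (periodic (M ∸ i)) + i       ≡⟨ cong (λ ρ → level (periodic ρ) + i) (far-residue (ℕₚ.≤-<-trans z≤n k<i) i≤M eq) ⟨
    level (periodic (x % M)) + i       ∎
    where
    open ℕₚ.≤-Reasoning
    i≤M = ℕₚ.<⇒≤ (ℕₚ.≰⇒> M≰i)
    M∸i≤ : M ∸ i ≤ suc k
    M∸i≤ = ℕₚ.≤-trans (ℕₚ.∸-monoʳ-≤ M k<i) (ℕₚ.≤-reflexive (ℕₚ.m+n∸n≡m (suc k) (suc k)))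

  -- This bounds the number of colours: levels 0 and `suc k` together will cost only `1 + 3`.
  Admissible : Symbol → Set
  Admissible (l , s) = l ≤ suc k × (l ≡ 0 → s ≡ 0F) × (l ≡ suc k → toℕ s < 3)

  periodic-admissible : ∀ {ρ} → ρ < M → Admissible (periodic ρ)
  periodic-admissible {ρ} ρ<M with ρ ≤? suc k
  ... | yes ρ≤ = ρ≤ , (λ _ → refl) , λ _ → s≤s z≤n
  ... | no ρ≰  = ℕₚ.≤-trans (ℕₚ.∸-monoʳ-≤ M (ℕₚ.<⇒≤ (ℕₚ.≰⇒> ρ≰))) (ℕₚ.≤-reflexive (ℕₚ.m+n∸n≡m (suc k) (suc k)))
               , (λ eq → contradiction (ℕₚ.m<n⇒0<n∸m ρ<M) (subst (λ l → ¬ (0 < l)) (sym eq) λ ()))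
               , λ _ → s≤s (s≤s (s≤s z≤n))

  symbolAt-admissible : ∀ {p} (v : Position p) → Admissible (symbolAt v)
  symbolAt-admissible (near p≤) = p≤ , (λ _ → refl) , λ _ → s≤s z≤n
  symbolAt-admissible (extra y z e) with y <? z
  ... | yes y<z = ℕₚ.m≤n⇒m≤1+n (ℕₚ.m∸n≤m k y)
                , (λ eq → contradiction eq (ℕₚ.m>n⇒m∸n≢0 (min<k e y<z)))
                , λ eq → contradiction (ℕₚ.m∸n≤m k y) (ℕₚ.<⇒≱ (ℕₚ.≤-reflexive (sym eq)))
  ... | no y≮z  = ℕₚ.m∸n≤m (suc k) z
                , (λ eq → contradiction eq (ℕₚ.m>n⇒m∸n≢0 (s≤s (min≤k (swap-sum {y} e) (ℕₚ.≮⇒≥ y≮z)))))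
                , λ _ → s≤s (s≤s z≤n)
  symbolAt-admissible (far x _) = periodic-admissible (m%n<n x M)

-- Distances in the subdivided graph.

m<n∸1⇒1+m<n : ∀ {m} n → m < n ∸ 1 → suc m < n
m<n∸1⇒1+m<n (suc n) m<n = s≤s m<n

module Subdivision {N} (G : SimpleGraph N) (n : ℕ) (1<n : 1 < n) where

  open Neighbourhood G

  H : Graph
  H = subdivision G n

  -- The distance `i` of `x` from `z` is measured along the edge between `z` and `y`. Edges are
  -- stored with the smaller end first, hence the two orientations.
  data OnDart (z y : Fin N) : SubV G n → ℕ → Set where
    forward  : ∀ {p q j} → OnDart z y (inj₂ (z , y , p , q , j)) (suc (toℕ j))
    backward : ∀ {p q j i} → suc (toℕ j) + i ≡ n → OnDart z y (inj₂ (y , z , p , q , j)) i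

  data At (z : Fin N) : SubV G n → ℕ → Set where
    centre : At z (inj₁ z) 0
    onDart : ∀ {y x i} → OnDart z y x i → At z x i

  data SameEdge (d : ℕ) : SubV G n → SubV G n → Set where
    sameEdge : ∀ {u v p q j p′ q′ j′} → toℕ j ≤ toℕ j′ + d → toℕ j′ ≤ toℕ j + d →
               SameEdge d (inj₂ (u , v , p , q , j)) (inj₂ (u , v , p′ , q′ , j′))

  -- What a walk of length `d < n` forces on its ends: they lie on one edge with indices at most `d`
  -- apart, or around a common original vertex with distances from it adding up to at most `d`.
  data Near (d : ℕ) : SubV G n → SubV G n → Set where
    edge : ∀ {x y} → SameEdge d x y → Near d x y
    hub  : ∀ {z x y i j} → At z x i → At z y j → i + j ≤ d → Near d x y

  1+j<n : (j : Fin (n ∸ 1)) → suc (toℕ j) < n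
  1+j<n j = m<n∸1⇒1+m<n n (Finₚ.toℕ<n j)

  Near-mono : ∀ {d d′ x y} → d ≤ d′ → Near d x y → Near d′ x y
  Near-mono d≤ (edge (sameEdge a b)) =
    edge (sameEdge (ℕₚ.≤-trans a (ℕₚ.+-monoʳ-≤ _ d≤)) (ℕₚ.≤-trans b (ℕₚ.+-monoʳ-≤ _ d≤)))
  Near-mono d≤ (hub a b le) = hub a b (ℕₚ.≤-trans le d≤)

  -- When the new step enters an edge at one end, the hub might be the opposite end. The whole edge
  -- would then be traversed, which takes `n` steps and contradicts `suc d < n`.
  Near-step : ∀ {d x y z} → suc d < n → Adj H x y → Near d y z → Near (suc d) x z
  Near-step _ (inj₁ (orig n≡1 _)) _ = contradiction n≡1 (ℕₚ.<⇒≢ 1<n ∘ sym)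
  Near-step _ (inj₂ (orig n≡1 _)) _ = contradiction n≡1 (ℕₚ.<⇒≢ 1<n ∘ sym)
  Near-step {d} _ (inj₁ (first j≡0)) (edge (sameEdge {j′ = j′} _ b)) =
    hub centre (onDart forward) (s≤s (subst (λ t → toℕ j′ ≤ t + d) j≡0 b))
  Near-step _ (inj₁ (first j≡0)) (hub (onDart forward) b le) =
    hub centre b (ℕₚ.m≤n⇒m≤1+n (ℕₚ.≤-trans (ℕₚ.m≤n+m _ _) le))
  Near-step {d} d<n (inj₁ (first {j = j} j≡0)) (hub {j = i′} (onDart (backward {i = i} eq)) b le) =
    contradiction d<n (ℕₚ.≤⇒≯ (begin
      n                   ≡⟨ eq ⟨
      suc (toℕ j) + i     ≡⟨ cong (λ t → suc t + i) j≡0 ⟩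
      suc i               ≤⟨ s≤s (ℕₚ.≤-trans (ℕₚ.m≤m+n i i′) le) ⟩
      suc d               ∎))
    where open ℕₚ.≤-Reasoning
  Near-step {d} _ (inj₁ (last {j = j} eq)) (edge (sameEdge {j′ = j′} a _)) =
    hub centre (onDart (backward (ℕₚ.m+[n∸m]≡n (ℕₚ.<⇒≤ (1+j<n j′))))) (begin
      n ∸ suc (toℕ j′)                          ≡⟨ cong (_∸ suc (toℕ j′)) eq ⟨
      suc (suc (toℕ j)) ∸ suc (toℕ j′)          ≤⟨ ℕₚ.∸-monoˡ-≤ (suc (toℕ j′)) (s≤s (s≤s a)) ⟩
      suc (suc (toℕ j′ + d)) ∸ suc (toℕ j′)     ≡⟨ cong (_∸ toℕ j′) (ℕₚ.+-suc (toℕ j′) d) ⟨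
      toℕ j′ + suc d ∸ toℕ j′                   ≡⟨ ℕₚ.m+n∸m≡n (toℕ j′) (suc d) ⟩
      suc d                                     ∎)
    where open ℕₚ.≤-Reasoning
  Near-step {d} d<n (inj₁ (last {j = j} eq)) (hub {j = i′} (onDart forward) b le) =
    contradiction d<n (ℕₚ.≤⇒≯ (ℕₚ.≤-trans (ℕₚ.≤-reflexive (sym eq))
      (s≤s (ℕₚ.≤-trans (ℕₚ.m≤m+n (suc (toℕ j)) i′) le))))
  Near-step _ (inj₁ (last eq)) (hub (onDart (backward _)) b le) =
    hub centre b (ℕₚ.m≤n⇒m≤1+n (ℕₚ.≤-trans (ℕₚ.m≤n+m _ _) le))
  Near-step {d} _ (inj₁ (inner {j = j} {j′} eq)) (edge (sameEdge {j′ = j″} a b)) = edge (sameEdge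
    (ℕₚ.≤-trans (ℕₚ.n≤1+n _) (subst (_≤ toℕ j″ + suc d) eq (ℕₚ.≤-trans a (ℕₚ.+-monoʳ-≤ _ (ℕₚ.n≤1+n d)))))
    (ℕₚ.≤-trans b (ℕₚ.≤-reflexive (trans (cong (_+ d) eq) (sym (ℕₚ.+-suc (toℕ j) d))))))
  Near-step _ (inj₁ (inner {j = j} eq)) (hub {j = i′} (onDart forward) b le) =
    hub (onDart forward) b (ℕₚ.m≤n⇒m≤1+n (ℕₚ.≤-trans (ℕₚ.+-monoˡ-≤ i′ (s≤s (ℕₚ.<⇒≤ (ℕₚ.≤-reflexive (sym eq))))) le))
  Near-step _ (inj₁ (inner {j = j} eq)) (hub (onDart (backward {i = i} e)) b le) =
    hub (onDart (backward (trans (ℕₚ.+-suc (suc (toℕ j)) i) (trans (cong (λ t → suc t + i) (sym eq)) e)))) b (s≤s le)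
  Near-step {d} _ (inj₂ (first {j = j} j≡0)) (hub centre b le) =
    hub (onDart forward) b (subst (λ t → suc t + _ ≤ suc d) (sym j≡0) (s≤s le))
  Near-step _ (inj₂ (last {j = j} eq)) (hub centre b le) =
    hub (onDart (backward (trans (ℕₚ.+-comm (suc (toℕ j)) 1) eq))) b (s≤s le)
  Near-step {d} _ (inj₂ (inner {j = j} {j′} eq)) (edge (sameEdge {j′ = j″} a b)) = edge (sameEdge
    (ℕₚ.≤-trans (ℕₚ.≤-reflexive eq) (ℕₚ.≤-trans (s≤s a) (ℕₚ.≤-reflexive (sym (ℕₚ.+-suc (toℕ j″) d)))))
    (ℕₚ.≤-trans b (ℕₚ.+-mono-≤ (ℕₚ.<⇒≤ (ℕₚ.≤-reflexive (sym eq))) (ℕₚ.n≤1+n d))))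
  Near-step {d} _ (inj₂ (inner {j = j} eq)) (hub {j = i′} (onDart forward) b le) =
    hub (onDart forward) b (subst (λ t → suc t + i′ ≤ suc d) (sym eq) (s≤s le))
  Near-step _ (inj₂ (inner {j = j} {j′} eq)) (hub {j = i′} (onDart (backward {i = i} e)) b le) =
    hub (onDart (backward (ℕₚ.m+[n∸m]≡n (ℕₚ.<⇒≤ (1+j<n j′))))) b
      (ℕₚ.m≤n⇒m≤1+n (ℕₚ.≤-trans (ℕₚ.+-monoˡ-≤ i′ closer) le))
    where
    closer : n ∸ suc (toℕ j′) ≤ i
    closer = ℕₚ.m≤n+o⇒m∸n≤o _ (suc (toℕ j′)) (begin
      n                        ≡⟨ e ⟨
      suc (toℕ j) + i          ≤⟨ ℕₚ.+-monoˡ-≤ i (ℕₚ.≤-trans (ℕₚ.≤-reflexive (sym eq)) (ℕₚ.n≤1+n _)) ⟩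
      suc (toℕ j′) + i         ∎)
      where open ℕₚ.≤-Reasoning

  walk⇒Near : ∀ {d x y} → d < n → Walk H d x y → Near d x y
  walk⇒Near {x = inj₁ _} _ here = hub centre centre z≤n
  walk⇒Near {x = inj₂ _} _ here = edge (sameEdge (ℕₚ.m≤m+n _ 0) (ℕₚ.m≤m+n _ 0))
  walk⇒Near d<n (step x~y w) = Near-step d<n x~y (walk⇒Near (ℕₚ.<⇒≤ d<n) w)

  OnDart⇒~ : ∀ {z y x i} → OnDart z y x i → z ~ y
  OnDart⇒~ (forward {q = q})    = q
  OnDart⇒~ (backward {q = q} _) = ~-sym q

  OnDart⇒0<i : ∀ {z y x i} → OnDart z y x i → 0 < i
  OnDart⇒0<i forward = s≤s z≤n
  OnDart⇒0<i (backward {j = j} {zero} eq) =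
    contradiction (1+j<n j) (ℕₚ.≤⇒≯ (ℕₚ.≤-reflexive (trans (sym eq) (ℕₚ.+-identityʳ _))))
  OnDart⇒0<i (backward {i = suc _} _) = s≤s z≤n

  OnDart-functional : ∀ {z y y′ x i i′} → OnDart z y x i → OnDart z y′ x i′ → y ≡ y′ × i ≡ i′
  OnDart-functional forward forward = refl , refl
  OnDart-functional (forward {p = p}) (backward _) = contradiction refl (Finₚ.<⇒≢ p)
  OnDart-functional (backward {p = p} _) forward = contradiction refl (Finₚ.<⇒≢ p)
  OnDart-functional (backward {j = j} e) (backward e′) =
    refl , ℕₚ.+-cancelˡ-≡ (suc (toℕ j)) _ _ (trans e (sym e′))

  OnDart⇒SameEdge : ∀ {z y x x′ i i′ d} → OnDart z y x i → OnDart z y x′ i′ → i ≤ d → i′ ≤ d → SameEdge d x x′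
  OnDart⇒SameEdge (forward {j = j}) (forward {j = j′}) i≤ i′≤ =
    sameEdge (ℕₚ.≤-trans (ℕₚ.<⇒≤ i≤) (ℕₚ.m≤n+m _ (toℕ j′))) (ℕₚ.≤-trans (ℕₚ.<⇒≤ i′≤) (ℕₚ.m≤n+m _ (toℕ j)))
  OnDart⇒SameEdge (forward {p = p}) (backward {p = p′} _) _ _ = contradiction p′ (ℕₚ.<-asym p)
  OnDart⇒SameEdge (backward {p = p} _) (forward {p = p′}) _ _ = contradiction p′ (ℕₚ.<-asym p)
  OnDart⇒SameEdge (backward e) (backward e′) i≤ i′≤ = sameEdge (bound e e′ i′≤) (bound e′ e i≤)
    where
    bound : ∀ {j j′ i i′ d} → suc j + i ≡ n → suc j′ + i′ ≡ n → i′ ≤ d → j ≤ j′ + d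
    bound {j} {j′} {i} {i′} e e′ i′≤ = ℕₚ.≤-trans
      (subst (j ≤_) (ℕₚ.suc-injective (trans e (sym e′))) (ℕₚ.m≤m+n j i)) (ℕₚ.+-monoʳ-≤ j′ i′≤)

  SameEdge⇒≡ : ∀ {u v p q j p′ q′ j′} → j ≡ j′ →
    _≡_ {A = SubV G n} (inj₂ (u , v , p , q , j)) (inj₂ (u , v , p′ , q′ , j′))
  SameEdge⇒≡ {p = p} {q} {p′ = p′} {q′} refl
    rewrite Finₚ.<-irrelevant p p′ | uip q q′ = refl

-- Turning symbols into colours, and counting the colours.

module Bicolouring {D} (4≤D : 4 ≤ D) {a b : Fin D} (a≢b : a ≢ b) where

  private
    e∉ = fresh (a ∷ b ∷ []) (ℕₚ.<⇒≤ 4≤D)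
    d∉ = fresh (a ∷ proj₁ e∉ ∷ b ∷ []) 4≤D
    e = proj₁ e∉
    d = proj₁ d∉

  -- The order matches the symbols: `0F` and `2F` select the dart colours `a` and `b`, while `1F`
  -- and `3F` select the two fresh ones.
  palette : List (Fin D)
  palette = a ∷ e ∷ b ∷ d ∷ []

  palette-unique : Unique palette
  palette-unique =
    ((λ a≡e → proj₂ e∉ (here (sym a≡e))) ∷ a≢b ∷ (λ a≡d → proj₂ d∉ (here (sym a≡d))) ∷ []) ∷
    ((λ e≡b → proj₂ e∉ (there (here e≡b))) ∷ (λ e≡d → proj₂ d∉ (there (here (sym e≡d)))) ∷ []) ∷
    ((λ b≡d → proj₂ d∉ (there (there (here (sym b≡d))))) ∷ []) ∷
    [] ∷ []

module _ (k : ℕ) {D} (4≤D : 4 ≤ D) where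

  Colour : Set
  Colour = ℕ × Fin D

  -- Only levels 1 to `k` depend on the dart colours. Levels 0 and `suc k` use fixed colours common
  -- to all edges, which keeps their number small.
  paint : ∀ {a b : Fin D} → a ≢ b → ℕ → Fin 4 → Fin D
  paint a≢b zero    s = inject≤ s 4≤D
  paint a≢b (suc l) s with suc l ≤? k
  ... | yes _ = lookup palette s where open Bicolouring 4≤D a≢b
  ... | no _  = inject≤ s 4≤D

  paint-injective : ∀ {a b} (a≢b : a ≢ b) l {s t} → paint a≢b l s ≡ paint a≢b l t → s ≡ t
  paint-injective a≢b zero    eq = Finₚ.inject≤-injective _ _ _ _ eq
  paint-injective a≢b (suc l) eq with suc l ≤? k
  ... | yes _ = Unique⇒lookup-injective (Bicolouring.palette-unique 4≤D a≢b) eq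
  ... | no _  = Finₚ.inject≤-injective _ _ _ _ eq

  paint-start : ∀ {a b} (a≢b : a ≢ b) {l} → 0 < l → l ≤ k → paint a≢b l 0F ≡ a
  paint-start a≢b {suc l} _ l≤k with suc l ≤? k
  ... | yes _  = refl
  ... | no l≰k = contradiction l≤k l≰k

  paint-end : ∀ {a b} (a≢b : a ≢ b) {l} → 0 < l → l ≤ k → paint a≢b l 2F ≡ b
  paint-end a≢b {suc l} _ l≤k with suc l ≤? k
  ... | yes _  = refl
  ... | no l≰k = contradiction l≤k l≰k

  paint-outer : ∀ {a b} (a≢b : a ≢ b) s → paint a≢b (suc k) s ≡ inject≤ s 4≤D
  paint-outer a≢b s with suc k ≤? k
  ... | yes k<k = contradiction k<k ℕₚ.1+n≰n
  ... | no _    = refl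

  Legal : Colour → Set
  Legal (l , c) = l ≤ suc k × (l ≡ 0 → toℕ c ≡ 0) × (l ≡ suc k → toℕ c < 3)

  -- Level 0 takes a single code and level suc k at most three, which makes kD + 4 in total.
  code : Colour → ℕ
  code (zero  , _) = 0
  code (suc l , c) = suc (toℕ c + l * D)

  -- Level 0 has code 0, levels 1 to `k` fill the codes 1 to `k * D`, and level `suc k` adds at most
  -- three more.
  code-bound : ∀ x → Legal x → code x < k * D + 4
  code-bound (zero , c) _ = ℕₚ.≤-trans (s≤s z≤n) (ℕₚ.m≤n+m 4 (k * D))
  code-bound (suc l , c) (s≤s l≤k , _ , outer) with ℕₚ.m≤n⇒m<n∨m≡n l≤k
  ... | inj₁ l<k = begin-strict
    suc (toℕ c + l * D)    ≤⟨ ℕₚ.+-monoˡ-≤ (l * D) (Finₚ.toℕ<n c) ⟩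
    suc l * D              ≤⟨ ℕₚ.*-monoˡ-≤ D l<k ⟩
    k * D                  <⟨ ℕₚ.m<m+n (k * D) (s≤s z≤n) ⟩
    k * D + 4              ∎
    where open ℕₚ.≤-Reasoning
  ... | inj₂ refl = begin-strict
    suc (toℕ c) + k * D    ≡⟨ ℕₚ.+-comm _ (k * D) ⟩
    k * D + suc (toℕ c)    <⟨ ℕₚ.+-monoʳ-< (k * D) (s≤s (outer refl)) ⟩
    k * D + 4              ∎
    where open ℕₚ.≤-Reasoning

  code-injective : ∀ x y → Legal x → Legal y → code x ≡ code y → x ≡ y
  code-injective (zero , c) (zero , c′) (_ , o , _) (_ , o′ , _) _ =
    cong (0 ,_) (Finₚ.toℕ-injective (trans (o refl) (sym (o′ refl))))
  code-injective (suc l , c) (suc l′ , c′) _ _ eq =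
    cong₂ (λ l c → suc l , c) l≡l′ (Finₚ.toℕ-injective (ℕₚ.+-cancelʳ-≡ (l′ * D) _ _
      (subst (λ t → toℕ c + t * D ≡ toℕ c′ + l′ * D) l≡l′ eq′)))
    where
    eq′ = ℕₚ.suc-injective eq
    not< : ∀ {l l′} (c c′ : Fin D) → toℕ c + l * D ≡ toℕ c′ + l′ * D → ¬ (l < l′)
    not< {l} {l′} c c′ eq l<l′ = ℕₚ.<⇒≢ (begin-strict
      toℕ c + l * D       <⟨ ℕₚ.+-monoˡ-< (l * D) (Finₚ.toℕ<n c) ⟩
      suc l * D           ≤⟨ ℕₚ.*-monoˡ-≤ D l<l′ ⟩
      l′ * D              ≤⟨ ℕₚ.m≤n+m _ (toℕ c′) ⟩
      toℕ c′ + l′ * D     ∎) eq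
      where open ℕₚ.≤-Reasoning
    l≡l′ : l ≡ l′
    l≡l′ = ℕₚ.≤-antisym (ℕₚ.≮⇒≥ (not< c′ c (sym eq′))) (ℕₚ.≮⇒≥ (not< c c′ eq′))

-- The colouring of the fractional power.

module FracColouring {N} (G : SimpleGraph N) (k r q : ℕ) (r<M : r < suc k + suc k) {D} (4≤D : 4 ≤ D)
  (c : Fin N → Fin N → Fin D) (proper : DartColouring.Proper G (ℕₚ.<⇒≤ (ℕₚ.<⇒≤ 4≤D)) c)
  (good : ∀ {u v} → ¬ DartColouring.Bad G (ℕₚ.<⇒≤ (ℕₚ.<⇒≤ 4≤D)) c u v) where

  open Pattern k r q r<M
  open Neighbourhood G

  M≤n : M ≤ n
  M≤n = ℕₚ.≤-trans (ℕₚ.m≤n+m M r) r+M≤n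

  open Subdivision G n (ℕₚ.≤-trans (s≤s (ℕₚ.m≤n+m 1 k)) (ℕₚ.≤-trans (ℕₚ.+-monoʳ-≤ (suc k) (s≤s z≤n)) M≤n))

  ends-≢ : ∀ {u v} → u ~ v → c u v ≢ c v u
  ends-≢ u~v eq = good (u~v , eq)

  shade : ∀ {a b : Fin D} → a ≢ b → Symbol → Colour k 4≤D
  shade a≢b (l , s) = l , paint k 4≤D a≢b l s

  shade-injective : ∀ {a b} (a≢b : a ≢ b) {s t} → shade a≢b s ≡ shade a≢b t → s ≡ t
  shade-injective a≢b {l , s} {l′ , t} eq with cong proj₁ eq
  ... | refl = cong (l ,_) (paint-injective k 4≤D a≢b l (cong′ eq))
    where
    cong′ : ∀ {l} {c c′ : Fin D} → (l , c) ≡ (l , c′) → c ≡ c′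
    cong′ refl = refl

  shade-legal : ∀ {a b} (a≢b : a ≢ b) {s} → Admissible s → Legal k 4≤D (shade a≢b s)
  shade-legal a≢b {l , s} (l≤ , zero-level , outer) = l≤ , at-zero , at-outer
    where
    at-zero : l ≡ 0 → toℕ (paint k 4≤D a≢b l s) ≡ 0
    at-zero refl with zero-level refl
    ... | refl = Finₚ.toℕ-inject≤ 0F 4≤D
    at-outer : l ≡ suc k → toℕ (paint k 4≤D a≢b l s) < 3
    at-outer refl = subst (_< 3) (sym (trans (cong toℕ (paint-outer k 4≤D a≢b s)) (Finₚ.toℕ-inject≤ s 4≤D))) (outer refl)

  colour : SubV G n → Colour k 4≤D
  colour (inj₁ _)                   = 0 , inject≤ 0F 4≤D
  colour (inj₂ (u , v , _ , u~v , j)) = shade (ends-≢ u~v) (symbolAt (position (suc (toℕ j))))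

  colour-legal : ∀ x → Legal k 4≤D (colour x)
  colour-legal (inj₁ _) = z≤n , (λ _ → Finₚ.toℕ-inject≤ 0F 4≤D) , λ ()
  colour-legal (inj₂ (_ , _ , _ , u~v , j)) = shade-legal (ends-≢ u~v) (symbolAt-admissible (position (suc (toℕ j))))

  dart-colour : ∀ {z y x i} → OnDart z y x i → i ≤ k → colour x ≡ (i , c z y)
  dart-colour (forward {q = u~v} {j}) i≤k =
    trans (cong (shade (ends-≢ u~v)) (start-near (position (suc (toℕ j))) i≤k))
          (cong (_ ,_) (paint-start k 4≤D (ends-≢ u~v) (s≤s z≤n) i≤k))
  dart-colour on@(backward {q = u~v} {j} eq) i≤k =
    trans (cong (shade (ends-≢ u~v)) (end-near (position (suc (toℕ j))) eq (OnDart⇒0<i on) i≤k))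
          (cong (_ ,_) (paint-end k 4≤D (ends-≢ u~v) (OnDart⇒0<i on) i≤k))

  dart-level : ∀ {z y x i} → OnDart z y x i → k < i → M ≤ proj₁ (colour x) + i
  dart-level (forward {j = j}) k<i     = start-level (position (suc (toℕ j))) k<i
  dart-level (backward {j = j} eq) k<i = end-level (position (suc (toℕ j))) eq k<i

  -- The level is `i > 0` up to distance `k` and at least `M ∸ i > 0` beyond. Level 0 can thus recur
  -- inside an edge only at distance `M` or more from both ends.
  dart-≢centre : ∀ {z y x i} → OnDart z y x i → i < M → proj₁ (colour x) ≢ 0
  dart-≢centre {i = i} on i<M eq with i ≤? k
  ... | yes i≤k = ℕₚ.<⇒≢ (OnDart⇒0<i on) (trans (sym eq) (cong proj₁ (dart-colour on i≤k)))
  ... | no i≰k  = ℕₚ.<⇒≱ i<M (subst (λ l → M ≤ l + i) eq (dart-level on (ℕₚ.≰⇒> i≰k)))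

  -- As `i` is the smaller distance, `i ≤ k` and `x` has level `i`. If also `i′ ≤ k`, the dart
  -- colours at `z` differ; otherwise `x′` has level at least `M ∸ i′ > i`.
  darts-≢ : ∀ {z y y′ x x′ i i′} → OnDart z y x i → OnDart z y′ x′ i′ → y ≢ y′ →
            i + i′ < M → i ≤ i′ → colour x ≢ colour x′
  darts-≢ {z} {y} {y′} {x} {x′} {i} {i′} on on′ y≢y′ sum<M i≤i′ eq = helper (i′ ≤? k)
    where
    i≤k : i ≤ k
    i≤k = ℕₚ.≮⇒≥ λ k<i → ℕₚ.<⇒≱ sum<M (ℕₚ.+-mono-≤ k<i (ℕₚ.≤-trans k<i i≤i′))
    x-colour = dart-colour on i≤k
    helper : Dec (i′ ≤ k) → ⊥
    helper (yes i′≤k) = y≢y′ (proper z (OnDart⇒~ on) (OnDart⇒~ on′)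
      (cong proj₂ (trans (sym x-colour) (trans eq (dart-colour on′ i′≤k)))))
    helper (no i′≰k) = ℕₚ.<⇒≱ sum<M (subst (λ l → M ≤ l + i′)
      (cong proj₁ (trans (sym eq) x-colour)) (dart-level on′ (ℕₚ.≰⇒> i′≰k)))

  sameEdge-≢ : ∀ {d x x′} → d < M → SameEdge d x x′ → x ≢ x′ → colour x ≢ colour x′
  -- Each vertex is shaded with the adjacency proof stored in it; `uip` identifies the two proofs,
  -- so one injective `shade` serves both.
  sameEdge-≢ {d} d<M (sameEdge {q = u~v} {j = j} {q′ = u~v′} {j′} a b) x≢x′ eq
    rewrite uip u~v u~v′ with ℕₚ.<-cmp (toℕ j) (toℕ j′)
  ... | tri< j<j′ _ _ = symbolAt-window (position _) (position _) (s≤s j<j′)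
    (s≤s (ℕₚ.≤-<-trans b (ℕₚ.+-monoʳ-< (toℕ j) d<M))) (shade-injective (ends-≢ u~v′) eq)
  ... | tri> _ _ j′<j = symbolAt-window (position _) (position _) (s≤s j′<j)
    (s≤s (ℕₚ.≤-<-trans a (ℕₚ.+-monoʳ-< (toℕ j′) d<M))) (sym (shade-injective (ends-≢ u~v′) eq))
  ... | tri≈ _ j≡j′ _ = x≢x′ (SameEdge⇒≡ (Finₚ.toℕ-injective j≡j′))

  near-≢ : ∀ {d x x′} → d < M → Near d x x′ → x ≢ x′ → colour x ≢ colour x′
  near-≢ d<M (edge e) = sameEdge-≢ d<M e
  near-≢ d<M (hub centre centre _) x≢x′ _ = x≢x′ refl
  near-≢ d<M (hub centre (onDart on) le) _ eq = dart-≢centre on (ℕₚ.≤-<-trans le d<M) (cong proj₁ (sym eq))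
  near-≢ d<M (hub (onDart on) centre le) _ eq =
    dart-≢centre on (ℕₚ.≤-<-trans (ℕₚ.m+n≤o⇒m≤o _ le) d<M) (cong proj₁ eq)
  near-≢ {d} d<M (hub {i = i} {i′} (onDart {y} on) (onDart {y′} on′) le) x≢x′ eq with y Finₚ.≟ y′
  ... | yes refl = sameEdge-≢ d<M
    (OnDart⇒SameEdge on on′ (ℕₚ.m+n≤o⇒m≤o i le) (ℕₚ.m+n≤o⇒n≤o i le)) x≢x′ eq
  ... | no y≢y′ with ℕₚ.≤-total i i′
  ...   | inj₁ i≤i′ = darts-≢ on on′ y≢y′ (ℕₚ.≤-<-trans le d<M) i≤i′ eq
  ...   | inj₂ i′≤i = darts-≢ on′ on (y≢y′ ∘ sym)
    (ℕₚ.≤-<-trans (ℕₚ.≤-trans (ℕₚ.≤-reflexive (ℕₚ.+-comm i′ i)) le) d<M) i′≤i (sym eq)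

  fracColouring : ∀ {m} → m < M → Colorable (fracPower G m n) (k * D + 4)
  fracColouring {m} m<M = κ , κ-proper
    where
    κ : SubV G n → Fin (k * D + 4)
    κ x = fromℕ< (code-bound k 4≤D (colour x) (colour-legal x))
    κ-proper : ∀ x y → Adj (fracPower G m n) x y → κ x ≢ κ y
    κ-proper x y (x≢y , d , d≤m , w) eq =
      near-≢ m<M (Near-mono d≤m (walk⇒Near (ℕₚ.<-≤-trans (ℕₚ.≤-<-trans d≤m m<M) M≤n) w)) x≢y
        (code-injective k 4≤D _ _ (colour-legal x) (colour-legal y)
          (trans (sym (Finₚ.toℕ-fromℕ< _)) (trans (cong toℕ eq) (Finₚ.toℕ-fromℕ< _))))

-- A large clique around a vertex.

length-cartesianProduct : ∀ {A B : Set} (xs : List A) (ys : List B) →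
                          length (cartesianProduct xs ys) ≡ length xs * length ys
length-cartesianProduct []       ys = refl
length-cartesianProduct (x ∷ xs) ys = trans (length-++ (map (x ,_) ys))
  (cong₂ _+_ (length-map (x ,_) ys) (length-cartesianProduct xs ys))

Unique⇒AllPairs : ∀ {A : Set} {R : A → A → Set} {xs} → Unique xs →
                  (∀ {a b} → a ∈ xs → b ∈ xs → a ≢ b → R a b) → AllPairs R xs
Unique⇒AllPairs []          _ = []
Unique⇒AllPairs (x∉ ∷ uniq) f =
  All.tabulate (λ b∈ → f (here refl) (there b∈) (All.lookup x∉ b∈)) ∷
  Unique⇒AllPairs uniq (λ a∈ b∈ → f (there a∈) (there b∈))

module Walks {N} (G : SimpleGraph N) (n : ℕ) (1<n : 1 < n) where

  open Neighbourhood G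
  open Subdivision G n 1<n

  snoc : ∀ {d x y z} → Walk H d x y → Adj H y z → Walk H (suc d) x z
  snoc here       y~z = step y~z here
  snoc (step e w) y~z = step e (snoc w y~z)

  reverse : ∀ {d x y} → Walk H d x y → Walk H d y x
  reverse here       = here
  reverse (step e w) = snoc (reverse w) (swap e)

  append : ∀ {d d′ x y z} → Walk H d x y → Walk H d′ y z → Walk H (d + d′) x z
  append here       w′ = w′
  append (step e w) w′ = step e (append w w′)

  dart-walk : ∀ {z y x i} → OnDart z y x i → Walk H i (inj₁ z) x
  dart-walk (forward {j = j}) = along (toℕ j) refl
    where
    along : ∀ t {u v p q j} → toℕ j ≡ t → Walk H (suc t) (inj₁ u) (inj₂ (u , v , p , q , j))
    along zero        eq = step (inj₁ (first eq)) here
    along (suc t) {p = p} {q} {j} eq =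
      snoc (along t {p = p} {q} (Finₚ.toℕ-fromℕ< t<)) (inj₁ (inner (trans eq (cong suc (sym (Finₚ.toℕ-fromℕ< t<))))))
      where
      t< : t < n ∸ 1
      t< = ℕₚ.<-trans (ℕₚ.≤-reflexive (sym eq)) (Finₚ.toℕ<n j)
  dart-walk (backward {i = i} eq) = along i eq
    where
    along : ∀ i {u v p q j} → suc (toℕ j) + i ≡ n → Walk H i (inj₁ v) (inj₂ (u , v , p , q , j))
    along zero {p = p} {q} {j} eq = case OnDart⇒0<i (backward {p = p} {q} {j} eq) of λ ()
    along (suc zero) {j = j} eq = step (inj₁ (last (trans (ℕₚ.+-comm 1 (suc (toℕ j))) eq))) here
    along (suc (suc i)) {p = p} {q} {j} eq =
      snoc (along (suc i) {p = p} {q} eq′) (inj₂ (inner (Finₚ.toℕ-fromℕ< j+1<)))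
      where
      j+1< : suc (toℕ j) < n ∸ 1
      j+1< = ℕₚ.m+n≤o⇒m≤o∸n (suc (suc (toℕ j))) (ℕₚ.≤-trans
        (ℕₚ.≤-trans (ℕₚ.+-monoʳ-≤ (suc (suc (toℕ j))) (s≤s (z≤n {i})))
          (ℕₚ.≤-reflexive (sym (ℕₚ.+-suc (suc (toℕ j)) (suc i))))) (ℕₚ.≤-reflexive eq))
      eq′ : suc (toℕ (fromℕ< j+1<)) + suc i ≡ n
      eq′ = trans (cong (λ t → suc t + suc i) (Finₚ.toℕ-fromℕ< j+1<))
        (trans (sym (ℕₚ.+-suc (suc (toℕ j)) (suc i))) eq)

  pointAt : ∀ {z y i} → z ~ y → 0 < i → i < n → ∃ λ x → OnDart z y x i
  pointAt {z} {y} {suc i} z~y _ i<n with Finₚ.<-cmp z y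
  ... | tri< z<y _ _ = inj₂ (z , y , z<y , z~y , fromℕ< i<) ,
    subst (λ t → OnDart z y (inj₂ (z , y , z<y , z~y , fromℕ< i<)) (suc t)) (Finₚ.toℕ-fromℕ< i<) forward
    where
    i< : i < n ∸ 1
    i< = ℕₚ.m+n≤o⇒m≤o∸n (suc i) (subst (_≤ n) (ℕₚ.+-comm 1 (suc i)) i<n)
  ... | tri≈ _ z≡y _ = contradiction z≡y (~-irrefl z~y)
  ... | tri> _ _ y<z = inj₂ (y , z , y<z , ~-sym z~y , fromℕ< j<) ,
    backward (trans (cong (λ t → suc t + suc i) (Finₚ.toℕ-fromℕ< j<))
      (trans (sym (ℕₚ.+-suc j (suc i))) (ℕₚ.m∸n+n≡m i<n)))
    where
    j = n ∸ suc (suc i)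
    j< : j < n ∸ 1
    j< = ℕₚ.∸-monoʳ-< (s≤s (s≤s z≤n)) i<n

module Clique {N} (G : SimpleGraph N) (k n : ℕ) (m<n : suc (k + k) < n) where

  open Neighbourhood G

  private
    1<n : 1 < n
    1<n = ℕₚ.≤-<-trans (s≤s z≤n) m<n

  open Subdivision G n 1<n
  open Walks G n 1<n

  m : ℕ
  m = suc (k + k)

  module _ (z : Fin N) {y₀ : Fin N} (z~y₀ : z ~ y₀) where

    DartIndex : Fin N × ℕ → Set
    DartIndex (y , i) = z ~ y × 0 < i × i ≤ suc k

    inner-indices : List (Fin N × ℕ)
    inner-indices = cartesianProduct (neighbours z) (applyUpTo suc k)

    -- Only one vertex at distance `suc k` is taken: two of them, on different darts, would be
    -- `m + 1` steps apart by way of `z`.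
    indices : List (Fin N × ℕ)
    indices = (y₀ , suc k) ∷ inner-indices

    ∈-inner : ∀ {y i} → (y , i) ∈ inner-indices → z ~ y × 0 < i × i ≤ k
    ∈-inner {y} {i} ∈in with ∈-cartesianProduct⁻ (neighbours z) (applyUpTo suc k) ∈in
    ... | y∈ , i∈ with ∈-applyUpTo⁻ suc i∈
    ...   | i′ , i′<k , refl = proj₂ (∈-filter⁻ _ {xs = allFin N} y∈) , s≤s z≤n , i′<k

    ∈-indices : ∀ {a} → a ∈ indices → DartIndex a
    ∈-indices (here refl) = z~y₀ , s≤s z≤n , ℕₚ.≤-refl
    ∈-indices (there a∈) with ∈-inner a∈
    ... | z~y , 0<i , i≤k = z~y , 0<i , ℕₚ.m≤n⇒m≤1+n i≤k

    indices-unique : Unique indices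
    indices-unique =
      All.tabulate (λ a∈ eq → ℕₚ.1+n≰n (subst (_≤ k) (sym (cong proj₂ eq)) (proj₂ (proj₂ (∈-inner a∈))))) ∷
      Uniqueₚ.cartesianProduct⁺ (Uniqueₚ.filter⁺ _ (Uniqueₚ.allFin⁺ N))
        (Uniqueₚ.applyUpTo⁺₁ suc k (λ i<j _ eq → ℕₚ.<⇒≢ i<j (ℕₚ.suc-injective eq)))

    indices-close : ∀ {a b} → a ∈ indices → b ∈ indices → a ≢ b → proj₂ a + proj₂ b ≤ m
    indices-close (here refl) (here refl) a≢b = contradiction refl a≢b
    indices-close (here refl) (there b∈)  _   = s≤s (ℕₚ.+-monoʳ-≤ k (proj₂ (proj₂ (∈-inner b∈))))
    indices-close (there a∈)  b∈          _   =
      ℕₚ.≤-trans (ℕₚ.+-mono-≤ (proj₂ (proj₂ (∈-inner a∈))) (proj₂ (proj₂ (∈-indices b∈)))) (ℕₚ.≤-reflexive (ℕₚ.+-suc k k))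

    1+k<n : suc k < n
    1+k<n = ℕₚ.≤-<-trans (s≤s (ℕₚ.m≤m+n k k)) m<n

    dartPoint : ∀ {a} → DartIndex a → ∃ λ x → OnDart z (proj₁ a) x (proj₂ a)
    dartPoint (z~y , 0<i , i≤) = pointAt z~y 0<i (ℕₚ.≤-<-trans i≤ 1+k<n)

    dartIndex? : ∀ a → Dec (DartIndex a)
    dartIndex? (y , i) = (adj G z y Boolₚ.≟ true) ×-dec (0 <? i) ×-dec (i ≤? suc k)

    point : Fin N × ℕ → SubV G n
    point a with dartIndex? a
    ... | yes idx = proj₁ (dartPoint idx)
    -- Default value, never reached for members of `indices`.
    ... | no _    = inj₁ z

    point-onDart : ∀ {a} → a ∈ indices → OnDart z (proj₁ a) (point a) (proj₂ a)
    point-onDart {a} a∈ with dartIndex? a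
    ... | yes idx  = proj₂ (dartPoint idx)
    ... | no ¬idx = contradiction (∈-indices a∈) ¬idx

    clique : List (SubV G n)
    clique = inj₁ z ∷ map point indices

    Close : SubV G n → SubV G n → Set
    Close x y = x ≢ y × Adj (fracPower G m n) x y

    close : ∀ {x y d} → x ≢ y → d ≤ m → Walk H d x y → Close x y
    close x≢y d≤m w = x≢y , x≢y , _ , d≤m , w

    -- Two members on darts are joined through `z` by a walk of length at most `k + suc k = m`. They
    -- are distinct because a vertex on a dart at `z` determines both the dart and the distance.
    clique-isClique : IsClique (fracPower G m n) clique
    clique-isClique =
      Allₚ.map⁺ (All.tabulate λ a∈ → close (≢-dart (point-onDart a∈))
        (ℕₚ.≤-trans (proj₂ (proj₂ (∈-indices a∈))) (s≤s (ℕₚ.m≤m+n k k))) (dart-walk (point-onDart a∈))) ∷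
      AllPairsₚ.map⁺ (Unique⇒AllPairs indices-unique λ a∈ b∈ a≢b → close
        (distinct (point-onDart a∈) (point-onDart b∈) a≢b)
        (indices-close a∈ b∈ a≢b)
        (append (reverse (dart-walk (point-onDart a∈))) (dart-walk (point-onDart b∈))))
      where
      ≢-dart : ∀ {y x i} → OnDart z y x i → inj₁ z ≢ x
      ≢-dart forward      ()
      ≢-dart (backward _) ()
      distinct : ∀ {a b x x′} → OnDart z (proj₁ a) x (proj₂ a) → OnDart z (proj₁ b) x′ (proj₂ b) → a ≢ b → x ≢ x′
      distinct on on′ a≢b refl with OnDart-functional on on′
      ... | refl , refl = a≢b refl

    length-clique : length clique ≡ 2 + degree G z * k
    length-clique = cong suc (trans (length-map point indices) (cong suc
      (trans (length-cartesianProduct (neighbours z) (applyUpTo suc k))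
        (cong₂ _*_ (length-neighbours z) (length-applyUpTo suc k)))))

  -- A positive degree supplies the neighbour on whose dart the outermost vertex of the clique lies.
  clique-bound : ∀ {w} → (∀ xs → IsClique (fracPower G m n) xs → length xs ≤ w) →
                 ∀ z → 0 < degree G z → 2 + degree G z * k ≤ w
  clique-bound {w} max z 0<deg with neighbours z in eq
  ... | [] = contradiction 0<deg (subst (λ d → ¬ (0 < d)) (trans (cong length (sym eq)) (length-neighbours z)) λ ())
  ... | y ∷ _ = subst (_≤ w) (length-clique z z~y) (max _ (clique-isClique z z~y))
    where
    z~y : z ~ y
    z~y = proj₂ (∈-filter⁻ _ {xs = allFin N} (subst (y ∈_) (sym eq) (here refl)))

-- Comparing the number of colours with the clique number.

Colorable-mono : ∀ {H a b} → a ≤ b → Colorable H a → Colorable H b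
Colorable-mono a≤b (c , proper) = (λ x → inject≤ (c x) a≤b) ,
  λ x y x~y eq → proper x y x~y (Finₚ.inject≤-injective _ _ _ _ eq)

-- The divisor is at most `n`, so the quotient is positive and has the form `suc q`: every edge
-- contains a full period.
division : ∀ {M n} → suc M ≤ n → ∃ λ r → ∃ λ q → r < suc M × n ≡ r + suc q * suc M
division {M} {n} M≤n with n / suc M in eq | m≥n⇒m/n>0 M≤n
... | suc q | _ = n % suc M , q , m%n<n n (suc M) ,
  trans (m≡m%n+[m/n]*n n (suc M)) (cong (λ t → n % suc M + t * suc M) eq)

theorem5p4 : (m n : ℕ) → 0 < m → m < n → Odd m →
    (N : ℕ) (G : SimpleGraph N) → Connected G → NonComplete G → MaxDegree≥ G 4 →
    (w : ℕ) → IsCliqueNumber (fracPower G m n) w → Colorable (fracPower G m n) (w + 2)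
theorem5p4 m n _ m<n (k , refl) N G _ _ (v , 4≤deg) w (_ , maximal)
  -- `2 * k` unfolds to `k + (k + 0)`; the rewriting brings `m` into the form `suc (k + k)`.
  rewrite ℕₚ.+-identityʳ k =
  let r , q , r<M , n≡   = division (subst (_≤ n) (cong suc (sym (ℕₚ.+-suc k k))) m<n)
      c , proper , good = DartColouring.dartColouring G (ℕₚ.<⇒≤ (ℕₚ.<⇒≤ 4≤Δ)) degree≤Δ
  in Colorable-mono (palette≤ (Clique.clique-bound G k n m<n maximal z (ℕₚ.≤-trans (s≤s z≤n) 4≤Δ)))
       (subst (λ n → Colorable (fracPower G _ n) (k * Δ + 4)) (sym n≡)
         (FracColouring.fracColouring G k r q r<M 4≤Δ c proper good
           (ℕₚ.≤-reflexive (cong suc (sym (ℕₚ.+-suc k k))))))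
  where
  z : Fin N
  -- A vertex of maximum degree, with `v` as the initial candidate.
  z = argmax (degree G) v (allFin N)
  Δ : ℕ
  Δ = degree G z
  degree≤Δ : ∀ u → degree G u ≤ Δ
  degree≤Δ u = All.lookup (f[xs]≤f[argmax] {f = degree G} v (allFin N)) (∈-allFin u)
  4≤Δ : 4 ≤ Δ
  4≤Δ = ℕₚ.≤-trans 4≤deg (degree≤Δ v)
  palette≤ : 2 + Δ * k ≤ w → k * Δ + 4 ≤ w + 2
  palette≤ le = ℕₚ.≤-trans (ℕₚ.≤-reflexive (begin
    k * Δ + 4          ≡⟨ cong (_+ 4) (ℕₚ.*-comm k Δ) ⟩
    Δ * k + 4          ≡⟨ ℕₚ.+-assoc (Δ * k) 2 2 ⟨
    Δ * k + 2 + 2      ≡⟨ cong (_+ 2) (ℕₚ.+-comm (Δ * k) 2) ⟩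
    2 + Δ * k + 2      ∎)) (ℕₚ.+-monoˡ-≤ 2 le)
    where open ≡-Reasoning
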